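{- (i) For any loopless matroid $M$ on a nonempty finite set $E$ there exists a polynomial $p_M(x)\in x\mathbb{Z}[x]$ such that for every positive integer $k$ the number of Gallai $k$-colorings of $M$ equals $p_M(k)$. Specifically, $p_M(x)=\sum_{j\ge 1} a_j\,(x)_j$, where $(x)_j:=x(x-1)\cdots(x-j+1)$ and $a_j$ is the number of Gallai $j$-partitions of $M$. (ii) For any acyclic oriented matroid $M$ on a nonempty finite set $E$ there exists a polynomial $p_M(x)\in x\mathbb{Z}[x]$ such that for every positive integer $k$ the number of transitive $k$-colorings of $M$ equals $p_M(k)$. Specifically, $p_M(x)=\sum_{j\ge 1} a_j\,(x)_j$, where $a_j$ is the number of transitive $j$-partitions of $M$.
   Context: A matroid is loopless if it has no circuit of size 1; an oriented matroid is acyclic if it has no positive circuit (no signed circuit with $X^-=\varnothing$). Write $[k]=\{1,\dots,k\}$. A Gallai $k$-coloring of a matroid $M$ on $E$ is a function $\varepsilon:E\to[k]$ such that $|\varepsilon(X)|<|X|$ for every circuit $X$. A Gallai $k$-partition of $M$ is a (unordered) partition of $E$ into $k$ disjoint nonempty blocks $B_1,\dots,B_k$ such that for every circuit $X$, $|X\cap B_i|\ge 2$ for at least one $i$. A transitive $k$-coloring of an oriented matroid $M$ on $E$ is a function $\varepsilon:E\to[k]$ such that $\varepsilon(X^+)\cap\varepsilon(X^-)\ne\varnothing$ for every signed circuit $X=(X^+,X^-)$. A transitive $k$-partition of $M$ is a (unordered) partition of $E$ into $k$ disjoint nonempty blocks $B_1,\dots,B_k$ such that for every signed circuit $X=(X^+,X^-)$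 there is at least one $i$ with both $X^+\cap B_i\ne\varnothing$ and $X^-\cap B_i\ne\varnothing$. -}

module Defs where

open import Data.Fin using (Fin)
import Data.Fin.Properties as Fin
open import Data.Fin.Subset
open import Data.Fin.Subset.Properties using (_∈?_; ∩-comm)
open import Data.Integer using (ℤ; +_; 0ℤ; 1ℤ)
import Data.Integer as ℤ
open import Data.List using (List; []; _∷_; map)
open import Data.Nat using (ℕ; zero; suc; _<_; _≤_)
open import Data.Product using (∃-syntax; _×_; _,_; proj₁)
open import Data.Sum using (_⊎_)
open import Data.Vec using (tabulate)
open import Function.Bundles using (Inverse)
open import Level using (0ℓ)
open import Relation.Binary.Bundles using (Setoid)
import Relation.Binary.Construct.On as On
open import Relation.Binary.PropositionalEquality
  using (_≡_; _≢_; refl; trans; subst; _→-setoid_; setoid)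
open import Relation.Nullary using (does)
open import Relation.Nullary.Decidable using (_×-dec_)
open import Relation.Unary using (Pred; Decidable)

------------------------------------------------------------------------
-- Matroids and oriented matroids, by their circuit axioms

-- The ground set of n elements is Fin n.  Circuits form a decidable
-- predicate, i.e. a subset of the power set in the classical sense.

record Matroid (n : ℕ) : Set₁ where
  field
    Circuit     : Pred (Subset n) 0ℓ
    Circuit?    : Decidable Circuit
    nonempty    : ∀ {X} → Circuit X → Nonempty X
    minimal     : ∀ {X Y} → Circuit X → Circuit Y → X ⊆ Y → X ≡ Y
    elimination : ∀ {X Y e} → Circuit X → Circuit Y → X ≢ Y → e ∈ X ∩ Y →
                  ∃[ Z ] Circuit Z × Z ⊆ (X ∪ Y) - e

Loopless : ∀ {n} → Matroid n → Set
Loopless M = ∀ X → Circuit X → ∣ X ∣ ≢ 1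
  where open Matroid M

-- Disjointness is irrelevant, so that signed subsets with the same
-- positive and the same negative part are propositionally equal.

record SignedSubset (n : ℕ) : Set where
  constructor signed
  field
    pos neg   : Subset n
    .disjoint : Empty (pos ∩ neg)

infix 9 _⁺ _⁻

_⁺ _⁻ : ∀ {n} → SignedSubset n → Subset n
X ⁺ = SignedSubset.pos X
X ⁻ = SignedSubset.neg X

support : ∀ {n} → SignedSubset n → Subset n
support X = X ⁺ ∪ X ⁻

opposite : ∀ {n} → SignedSubset n → SignedSubset n
opposite (signed p q d) = signed q p (subst Empty (∩-comm p q) d)

record OrientedMatroid (n : ℕ) : Set₁ where
  field
    Circuit     : Pred (SignedSubset n) 0ℓ
    Circuit?    : Decidable Circuit
    nonempty    : ∀ {X} → Circuit X → Nonempty (support X)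
    symmetric   : ∀ {X} → Circuit X → Circuit (opposite X)
    minimal     : ∀ {X Y} → Circuit X → Circuit Y → support X ⊆ support Y →
                  X ≡ Y ⊎ X ≡ opposite Y
    elimination : ∀ {X Y e} → Circuit X → Circuit Y → X ≢ opposite Y →
                  e ∈ X ⁺ ∩ Y ⁻ →
                  ∃[ Z ] Circuit Z × Z ⁺ ⊆ (X ⁺ ∪ Y ⁺) - e
                                   × Z ⁻ ⊆ (X ⁻ ∪ Y ⁻) - e

Acyclic : ∀ {n} → OrientedMatroid n → Set
Acyclic M = ∀ X → Circuit X → X ⁻ ≢ ⊥
  where open OrientedMatroid M

------------------------------------------------------------------------
-- Cardinality

HasCard : Setoid 0ℓ 0ℓ → ℕ → Set
HasCard S m = Inverse S (setoid (Fin m))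

------------------------------------------------------------------------
-- Colorings; the color set [k] is Fin k

image : ∀ {n k} → (Fin n → Fin k) → Subset n → Subset k
image ε X = tabulate λ c → does (Fin.any? λ e → (e ∈? X) ×-dec (ε e Fin.≟ c))

IsGallaiColoring : ∀ {n k} → Matroid n → (Fin n → Fin k) → Set
IsGallaiColoring M ε = ∀ X → Circuit X → ∣ image ε X ∣ < ∣ X ∣
  where open Matroid M

IsTransitiveColoring : ∀ {n k} → OrientedMatroid n → (Fin n → Fin k) → Set
IsTransitiveColoring M ε =
  ∀ X → Circuit X → Nonempty (image ε (X ⁺) ∩ image ε (X ⁻))
  where open OrientedMatroid M

-- Colorings are compared pointwise, ignoring the proofs of validity.

GallaiColorings : ∀ {n} → Matroid n → ℕ → Setoid 0ℓ 0ℓ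
GallaiColorings {n} M k =
  On.setoid (Fin n →-setoid Fin k) (proj₁ {B = IsGallaiColoring M})

TransitiveColorings : ∀ {n} → OrientedMatroid n → ℕ → Setoid 0ℓ 0ℓ
TransitiveColorings {n} M k =
  On.setoid (Fin n →-setoid Fin k) (proj₁ {B = IsTransitiveColoring M})

------------------------------------------------------------------------
-- Partitions

record Partition (n k : ℕ) : Set where
  field
    block    : Fin k → Subset n
    nonempty : ∀ i → Nonempty (block i)
    disjoint : ∀ {i j} → i ≢ j → Empty (block i ∩ block j)
    covering : ∀ e → ∃[ i ] e ∈ block i

open Partition using (block)

-- Two partitions are identified when they have the same set of blocks,
-- so the indexing of the blocks by Fin k carries no information.

partitionSetoid : ℕ → ℕ → Setoid 0ℓ 0ℓ
partitionSetoid n k = record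
  { Carrier       = Partition n k
  ; _≈_           = λ P Q → P ≼ Q × Q ≼ P
  ; isEquivalence = record
    { refl  = λ {P} → ≼-refl P , ≼-refl P
    ; sym   = λ (p , q) → q , p
    ; trans = λ {P} {Q} {R} (p , q) (p′ , q′) →
                ≼-trans P Q R p p′ , ≼-trans R Q P q′ q
    }
  }
  where
  _≼_ : Partition n k → Partition n k → Set
  P ≼ Q = ∀ i → ∃[ j ] block P i ≡ block Q j

  ≼-refl : ∀ P → P ≼ P
  ≼-refl P i = i , refl

  ≼-trans : ∀ P Q R → P ≼ Q → Q ≼ R → P ≼ R
  ≼-trans P Q R p q i with j , r ← p i with l , s ← q j = l , trans r s

IsGallaiPartition : ∀ {n k} → Matroid n → Partition n k → Set
IsGallaiPartition M P = ∀ X → Circuit X → ∃[ i ] 2 ≤ ∣ X ∩ block P i ∣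
  where open Matroid M

IsTransitivePartition : ∀ {n k} → OrientedMatroid n → Partition n k → Set
IsTransitivePartition M P =
  ∀ X → Circuit X →
  ∃[ i ] Nonempty (X ⁺ ∩ block P i) × Nonempty (X ⁻ ∩ block P i)
  where open OrientedMatroid M

GallaiPartitions : ∀ {n} → Matroid n → ℕ → Setoid 0ℓ 0ℓ
GallaiPartitions {n} M k =
  On.setoid (partitionSetoid n k) (proj₁ {B = IsGallaiPartition M})

TransitivePartitions : ∀ {n} → OrientedMatroid n → ℕ → Setoid 0ℓ 0ℓ
TransitivePartitions {n} M k =
  On.setoid (partitionSetoid n k) (proj₁ {B = IsTransitivePartition M})

------------------------------------------------------------------------
-- Integer polynomials

-- Coefficient lists, constant term first, up to trailing zeros.

Poly : Set
Poly = List ℤ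

coeff : Poly → ℕ → ℤ
coeff []      _       = 0ℤ
coeff (c ∷ p) zero    = c
coeff (c ∷ p) (suc i) = coeff p i

infix  4 _≈ₚ_ _∈xℤ[x]
infixl 6 _+ₚ_
infixl 7 _*ₚ_ _·ₚ_

_≈ₚ_ : Poly → Poly → Set
p ≈ₚ q = ∀ i → coeff p i ≡ coeff q i

_+ₚ_ : Poly → Poly → Poly
[]      +ₚ q       = q
(c ∷ p) +ₚ []      = c ∷ p
(c ∷ p) +ₚ (d ∷ q) = (c ℤ.+ d) ∷ (p +ₚ q)

_·ₚ_ : ℤ → Poly → Poly
c ·ₚ p = map (c ℤ.*_) p

_*ₚ_ : Poly → Poly → Poly
[]      *ₚ q = []
(c ∷ p) *ₚ q = c ·ₚ q +ₚ (0ℤ ∷ p *ₚ q)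

eval : Poly → ℤ → ℤ
eval []      x = 0ℤ
eval (c ∷ p) x = c ℤ.+ x ℤ.* eval p x

𝕩 : Poly
𝕩 = 0ℤ ∷ 1ℤ ∷ []

const : ℤ → Poly
const c = c ∷ []

_∈xℤ[x] : Poly → Set
p ∈xℤ[x] = ∃[ q ] p ≈ₚ 𝕩 *ₚ q

-- falling j is (x)_j = x (x - 1) ⋯ (x - j + 1).

falling : ℕ → Poly
falling zero    = const 1ℤ
falling (suc j) = falling j *ₚ (𝕩 +ₚ const (ℤ.- (+ j)))

-- fallingSum a N is the sum of a j (x)_j over 1 ≤ j ≤ N.

fallingSum : (ℕ → ℕ) → ℕ → Poly
fallingSum a zero    = []
fallingSum a (suc N) = fallingSum a N +ₚ (+ a (suc N)) ·ₚ falling (suc N)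

-- p is the sum of a j (x)_j over all j ≥ 1; for this formally infinite
-- sum to be a polynomial, all but finitely many a j have to vanish.

IsFallingSum : (ℕ → ℕ) → Poly → Set
IsFallingSum a p =
  ∃[ N ] (∀ j → N < j → a j ≡ 0) × p ≈ₚ fallingSum a N

{-# OPTIONS --safe #-}
module Submission where

-- A coloring ε is Gallai iff every circuit contains two distinct elements
-- of the same color, and transitive iff every signed circuit contains a
-- positive and a negative element of the same color.  Both conditions
-- concern only the kernel of ε, that is the partition into color classes,
-- and for that partition they are the conditions defining Gallai and
-- transitive partitions.  Every ε : [n] → [k] factors uniquely as
-- a partition of [n] into some number j of blocks followed by an injection
-- [j] → [k], and there are (k)_j such injections.

open import Defs
open import Data.Bool using (true)
open import Data.Empty using (⊥-elim-irr)
open import Data.Fin using (Fin; zero; suc; punchIn; punchOut)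
import Data.Fin.Properties as Fin
open import Data.Fin.Properties
  using (any?; punchIn-injective; punchInᵢ≢i; punchIn-punchOut; punchOut-injective;
         suc-injective; 0≢1+n; cantor-schröder-bernstein)
open import Data.Fin.Subset
  using (Subset; inside; outside; ⊥; ⁅_⁆; ∣_∣; _∈_; _⊆_; _∩_; _∪_; _-_; Empty)
open import Data.Fin.Subset.Properties
  using (anySubset?; nonempty?; _∈?_; x∈p∩q⁺; x∈p∩q⁻; x∈p∪q⁺; x∈⁅x⁆; ∣⁅x⁆∣≡1; ∣⊥∣≡0; ∣p∣≤n;
         ∣p∣≤∣x∷p∣; p⊆q⇒∣p∣≤∣q∣; x∈p⇒∣p-x∣<∣p∣; x∈p∧x≢y⇒x∈p-y; ⊆-antisym)
open import Data.Integer as ℤ using (ℤ; +_; 0ℤ; 1ℤ)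
import Data.Integer.Properties as ℤ
open import Data.Integer.Tactic.RingSolver using (solve-∀)
open import Data.List as List
  using (List; []; _∷_; _++_; length; lookup; filter; allFin; cartesianProductWith)
open import Data.List.Membership.Propositional using () renaming (_∈_ to _∈ₗ_)
open import Data.List.Membership.Propositional.Properties
  using (∈-lookup; ∈-++⁺ˡ; ∈-++⁺ʳ; ∈-++⁻; ∈-map⁺; ∈-map⁻; ∈-filter⁺; ∈-filter⁻; ∈-allFin;
         ∈-cartesianProductWith⁺; ∈-cartesianProductWith⁻)
import Data.List.Membership.Setoid as SetoidMembership
import Data.List.Membership.Setoid.Properties as SetoidMembershipₚ
open import Data.List.Properties using (length-map; length-++; length-tabulate)
open import Data.List.Relation.Binary.Disjoint.Propositional using (Disjoint)
open import Data.List.Relation.Unary.All as All using (All)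
import Data.List.Relation.Unary.All.Properties as All
open import Data.List.Relation.Unary.AllPairs using ([]; _∷_)
open import Data.List.Relation.Unary.Any as Any using (here; there)
open import Data.List.Relation.Unary.Any.Properties using (lookup-index)
open import Data.List.Relation.Unary.Unique.Propositional using (Unique)
import Data.List.Relation.Unary.Unique.Propositional.Properties as Unique
import Data.List.Relation.Unary.Unique.Setoid as SetoidUnique
import Data.List.Relation.Unary.Unique.Setoid.Properties as SetoidUniqueₚ
open import Data.Nat as ℕ
  using (ℕ; zero; suc; _≤_; _<_; _≥_; z≤n; s≤s; NonZero)
open import Data.Nat.Properties
  using (≤-reflexive; ≤-trans; ≤-<-trans; ≤-pred; ≤⇒≯; m≤n⇒m<n∨m≡n; m≤n⇒m≤1+n; +-suc; +-monoʳ-≤;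
         module ≤-Reasoning)
open import Data.Product using (Σ; ∃; ∃-syntax; ∃₂; _×_; _,_; proj₁; proj₂)
open import Data.Sum using (inj₁; inj₂)
open import Data.Vec using ([]; _∷_; tabulate; here; there)
open import Data.Vec.Properties using (lookup⇒[]=; []=⇒lookup; lookup∘tabulate)
open import Function using (_∘_; id; Injective)
open import Level using (0ℓ)
open import Relation.Binary.Bundles using (Setoid)
import Relation.Binary.Construct.On as On
open import Relation.Binary.Core using (Rel; _⇒_)
import Relation.Binary.Definitions as Binary
open import Relation.Binary.PropositionalEquality
  using (_≡_; _≢_; _≗_; _→-setoid_; setoid; refl; sym; trans; cong; cong₂; subst;
         module ≡-Reasoning)
open import Relation.Nullary using (Dec; yes; no; does; proof; invert; contradiction)
open import Relation.Nullary.Decidable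
  using (map′; ¬?; decidable-stable; dec-true; _×-dec_; _→-dec_)
open import Relation.Nullary.Reflects using (Reflects)
open import Relation.Unary using (Decidable)

open Partition

-- Counting by listing

module _ (S : Setoid 0ℓ 0ℓ) where
  open Setoid S using (Carrier; _≈_) renaming (refl to ≈-refl; sym to ≈-sym; trans to ≈-trans)
  open SetoidMembership S using () renaming (_∈_ to _∈ₛ_)
  open SetoidUnique S using () renaming (Unique to Uniqueₛ)

  lookup-injective : ∀ {xs} → Uniqueₛ xs → ∀ i j → lookup xs i ≈ lookup xs j → i ≡ j
  lookup-injective (_ ∷ _)   zero    zero    _  = refl
  lookup-injective (x# ∷ _)  zero    (suc j) eq = contradiction eq (All.lookup x# (∈-lookup j))
  lookup-injective (x# ∷ _)  (suc i) zero    eq = contradiction (≈-sym eq) (All.lookup x# (∈-lookup i))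
  lookup-injective (_ ∷ xs!) (suc i) (suc j) eq = cong suc (lookup-injective xs! i j eq)

  -- The restricted setoid compares carriers only, so sending an element to its position in the list
  -- is well defined whatever its proof of `P`. Completeness gives the position, and the absence of
  -- repetitions makes it unique.
  hasCard-length : {P : Carrier → Set} (xs : List Carrier) → Uniqueₛ xs → All P xs →
                   (∀ {x} → P x → x ∈ₛ xs) →
                   HasCard (On.setoid S (proj₁ {B = P})) (length xs)
  hasCard-length {P} xs xs! Pxs complete = record
    { to        = to
    ; from      = λ i → lookup xs i , All.lookup Pxs (∈-lookup i)
    ; to-cong   = λ {x} {y} x≈y → lookup-injective xs! (to x) (to y)
                    (≈-trans (≈-sym (found x)) (≈-trans x≈y (found y)))
    ; from-cong = λ { refl → ≈-refl }
    ; inverse   = (λ {i} {x} x≈ → lookup-injective xs! (to x) i (≈-trans (≈-sym (found x)) x≈))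
                , (λ { {x} refl → ≈-sym (found x) })
    }
    where
    to : ∃ P → Fin (length xs)
    to (x , px) = Any.index (complete px)

    found : ∀ x → proj₁ x ≈ lookup xs (to x)
    found (x , px) = lookup-index (complete px)

-- Restricted growth strings

-- Set partitions of [n] into j blocks, coded from the last element to the
-- first: every element joins an existing block or opens
-- a new one, which is then given the number zero.

data RGS : ℕ → ℕ → Set where
  []  : RGS 0 0
  old : ∀ {n j} → Fin j → RGS n j → RGS (suc n) j
  new : ∀ {n j} → RGS n j → RGS (suc n) (suc j)

label : ∀ {n j} → RGS n j → Fin n → Fin j
label (old i r) zero    = i
label (old i r) (suc e) = label r e
label (new r)   zero    = zero
label (new r)   (suc e) = suc (label r e)

label-surjective : ∀ {n j} (r : RGS n j) i → ∃[ e ] label r e ≡ i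
label-surjective (old _ r) i       with e , eq ← label-surjective r i = suc e , eq
label-surjective (new r)   zero    = zero , refl
label-surjective (new r)   (suc i) with e , eq ← label-surjective r i = suc e , cong suc eq

RGS⇒≤ : ∀ {n j} → RGS n j → j ≤ n
RGS⇒≤ []        = z≤n
RGS⇒≤ (old _ r) = m≤n⇒m≤1+n (RGS⇒≤ r)
RGS⇒≤ (new r)   = s≤s (RGS⇒≤ r)

RGS-nonempty : ∀ {n j} → RGS (suc n) j → 1 ≤ j
RGS-nonempty (old zero _)    = s≤s z≤n
RGS-nonempty (old (suc _) _) = s≤s z≤n
RGS-nonempty (new _)         = s≤s z≤n

infix 4 _≈ₖ_

-- Equality of kernels. The codomains may differ, because the numbers of classes of two maps are
-- compared only after their kernels.
_≈ₖ_ : ∀ {n j k} → (Fin n → Fin j) → (Fin n → Fin k) → Set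
ε ≈ₖ δ = ∀ e f → (ε e ≡ ε f → δ e ≡ δ f) × (δ e ≡ δ f → ε e ≡ ε f)

≈ₖ-tail : ∀ {n j k} {ε : Fin (suc n) → Fin j} {δ : Fin (suc n) → Fin k} →
          ε ≈ₖ δ → ε ∘ suc ≈ₖ δ ∘ suc
≈ₖ-tail eq e f = eq (suc e) (suc f)

-- The kernel tells whether the first element shares a class with a later one. If it does, its label
-- is forced by that element; if not, it must open a new block. The number of blocks is part of the
-- conclusion, hence the equality of pairs.
label-canonical : ∀ {n j k} (r : RGS n j) (s : RGS n k) → label r ≈ₖ label s →
                  _≡_ {A = ∃ (RGS n)} (j , r) (k , s)
label-canonical []        []        eq = refl
label-canonical (old i r) (old l s) eq with label-canonical r s (≈ₖ-tail eq)
-- Block `i` contains some `e`. The first element lies with it in both strings, which forces `l` to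
-- be `i`.
... | refl with e , refl ← label-surjective r i =
  cong (λ m → _ , old m r) (sym (proj₁ (eq zero (suc e)) refl))
label-canonical (old i r) (new s)   eq with e , refl ← label-surjective r i =
  contradiction (proj₁ (eq zero (suc e)) refl) 0≢1+n
label-canonical (new r)   (old i s) eq with e , refl ← label-surjective s i =
  contradiction (proj₂ (eq zero (suc e)) refl) 0≢1+n
label-canonical (new r)   (new s)   eq
  with label-canonical r s (λ e f → suc-injective ∘ proj₁ (eq (suc e) (suc f)) ∘ cong suc
                                   , suc-injective ∘ proj₂ (eq (suc e) (suc f)) ∘ cong suc)
... | refl = refl

-- The map `h` lists the colors used so far, one per block. The first element joins the block of its
-- color if `h` already takes that color; otherwise it opens a new block, and the failed search is
-- exactly what keeps the extended `h` injective.
factorize : ∀ {n k} (ε : Fin n → Fin k) →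
            ∃[ j ] Σ (RGS n j) λ r → Σ (Fin j → Fin k) λ h → Injective _≡_ _≡_ h × h ∘ label r ≗ ε
factorize {zero}  ε = 0 , [] , (λ ()) , (λ { {()} }) , λ ()
factorize {suc n} ε with j , r , h , h-inj , eq ← factorize (ε ∘ suc)
                 with any? (λ i → h i Fin.≟ ε zero)
... | yes (i , hi≡) = j , old i r , h , h-inj , λ { zero → hi≡ ; (suc e) → eq e }
... | no  ε₀∉h      = suc j , new r , h′ , h′-inj , λ { zero → refl ; (suc e) → eq e }
  where
  h′ : Fin (suc j) → Fin _
  h′ zero    = ε zero
  h′ (suc i) = h i

  h′-inj : Injective _≡_ _≡_ h′
  h′-inj {zero}  {zero}  _  = refl
  h′-inj {zero}  {suc i} eq = contradiction (i , sym eq) ε₀∉h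
  h′-inj {suc i} {zero}  eq = contradiction (i , eq) ε₀∉h
  h′-inj {suc i} {suc l} eq = cong suc (h-inj eq)

rgs : ∀ n j → List (RGS n j)
rgs zero    zero    = [] ∷ []
rgs zero    (suc j) = []
rgs (suc n) zero    = []
rgs (suc n) (suc j) =
  cartesianProductWith old (allFin (suc j)) (rgs n (suc j)) ++ List.map new (rgs n j)

∈-rgs : ∀ {n j} (r : RGS n j) → r ∈ₗ rgs n j
∈-rgs []                    = here refl
∈-rgs {j = suc j} (old i r) = ∈-++⁺ˡ (∈-cartesianProductWith⁺ old (∈-allFin i) (∈-rgs r))
∈-rgs (new r)               =
  ∈-++⁺ʳ (cartesianProductWith old (allFin _) (rgs _ _)) (∈-map⁺ new (∈-rgs r))

rgs-unique : ∀ n j → Unique (rgs n j)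
rgs-unique zero    zero    = All.[] ∷ []
rgs-unique zero    (suc j) = []
rgs-unique (suc n) zero    = []
rgs-unique (suc n) (suc j) = Unique.++⁺
  (Unique.cartesianProductWith⁺ old (λ { refl → refl , refl })
    (Unique.allFin⁺ (suc j)) (rgs-unique n (suc j)))
  (Unique.map⁺ (λ { refl → refl }) (rgs-unique n j))
  old#new
  where
  old#new : Disjoint (cartesianProductWith old (allFin (suc j)) (rgs n (suc j)))
                     (List.map new (rgs n j))
  old#new (r∈old , r∈new)
    with _ , _ , _ , _ , refl ← ∈-cartesianProductWith⁻ old (allFin (suc j)) (rgs n (suc j)) r∈old
    with _ , _ , () ← ∈-map⁻ new r∈new

-- Arrangements

-- Injections from [j] to [k] as first-order data, so that pointwise equality becomes propositional
-- equality. The head is the value at zero; the tail takes its values among the remaining colors,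
-- renumbered by `punchIn`.
data Arrangement : ℕ → ℕ → Set where
  []  : ∀ {k} → Arrangement 0 k
  _∷_ : ∀ {j k} → Fin (suc k) → Arrangement j k → Arrangement (suc j) (suc k)

apply : ∀ {j k} → Arrangement j k → Fin j → Fin k
apply (c ∷ f) zero    = c
apply (c ∷ f) (suc i) = punchIn c (apply f i)

apply-injective : ∀ {j k} (f : Arrangement j k) → Injective _≡_ _≡_ (apply f)
apply-injective (c ∷ f) {zero}  {zero}  _  = refl
apply-injective (c ∷ f) {zero}  {suc l} eq = contradiction (sym eq) (punchInᵢ≢i c _)
apply-injective (c ∷ f) {suc i} {zero}  eq = contradiction eq (punchInᵢ≢i c _)
apply-injective (c ∷ f) {suc i} {suc l} eq = cong suc (apply-injective f (punchIn-injective c _ _ eq))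

apply-cancel : ∀ {j k} (f g : Arrangement j k) → apply f ≗ apply g → f ≡ g
apply-cancel []      []      _  = refl
apply-cancel (c ∷ f) (d ∷ g) eq with refl ← eq zero =
  cong (c ∷_) (apply-cancel f g (punchIn-injective c _ _ ∘ eq ∘ suc))

arrange : ∀ {j k} (h : Fin j → Fin k) → Injective _≡_ _≡_ h → ∃[ f ] apply {j} {k} f ≗ h
arrange {zero}          h h-inj = [] , λ ()
arrange {suc j} {zero}  h h-inj with () ← h zero
arrange {suc j} {suc k} h h-inj = h zero ∷ proj₁ rest , λ
  { zero    → refl
  ; (suc i) → trans (cong (punchIn (h zero)) (proj₂ rest i)) (punchIn-punchOut (h₀≢ i))
  }
  where
  h₀≢ : ∀ i → h zero ≢ h (suc i)
  h₀≢ i eq = 0≢1+n (h-inj eq)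

  -- The later values avoid `h zero`, so deleting that color leaves an injection into a color set
  -- that is smaller by one.
  rest : ∃[ f ] apply {j} {k} f ≗ λ i → punchOut (h₀≢ i)
  rest = arrange (λ i → punchOut (h₀≢ i)) (suc-injective ∘ h-inj ∘ punchOut-injective (h₀≢ _) (h₀≢ _))

arrangements : ∀ j k → List (Arrangement j k)
arrangements zero    k       = [] ∷ []
arrangements (suc j) zero    = []
arrangements (suc j) (suc k) = cartesianProductWith _∷_ (allFin (suc k)) (arrangements j k)

∈-arrangements : ∀ {j k} (f : Arrangement j k) → f ∈ₗ arrangements j k
∈-arrangements []      = here refl
∈-arrangements (c ∷ f) = ∈-cartesianProductWith⁺ _∷_ (∈-allFin c) (∈-arrangements f)

arrangements-unique : ∀ j k → Unique (arrangements j k)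
arrangements-unique zero    k       = All.[] ∷ []
arrangements-unique (suc j) zero    = []
arrangements-unique (suc j) (suc k) =
  Unique.cartesianProductWith⁺ _∷_ (λ { refl → refl , refl })
    (Unique.allFin⁺ (suc k)) (arrangements-unique j k)

-- Evaluation of polynomials

eval-+ : ∀ p q x → eval (p +ₚ q) x ≡ eval p x ℤ.+ eval q x
eval-+ []      q       x = sym (ℤ.+-identityˡ _)
eval-+ (c ∷ p) []      x = sym (ℤ.+-identityʳ _)
eval-+ (c ∷ p) (d ∷ q) x =
  trans (cong (λ y → c ℤ.+ d ℤ.+ x ℤ.* y) (eval-+ p q x)) (lemma c d x (eval p x) (eval q x))
  where
  lemma : ∀ c d x y z → c ℤ.+ d ℤ.+ x ℤ.* (y ℤ.+ z) ≡ (c ℤ.+ x ℤ.* y) ℤ.+ (d ℤ.+ x ℤ.* z)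
  lemma = solve-∀

eval-· : ∀ c p x → eval (c ·ₚ p) x ≡ c ℤ.* eval p x
eval-· c []      x = sym (ℤ.*-zeroʳ c)
eval-· c (d ∷ p) x =
  trans (cong (λ y → c ℤ.* d ℤ.+ x ℤ.* y) (eval-· c p x)) (lemma c d x (eval p x))
  where
  lemma : ∀ c d x y → c ℤ.* d ℤ.+ x ℤ.* (c ℤ.* y) ≡ c ℤ.* (d ℤ.+ x ℤ.* y)
  lemma = solve-∀

eval-* : ∀ p q x → eval (p *ₚ q) x ≡ eval p x ℤ.* eval q x
eval-* []      q x = sym (ℤ.*-zeroˡ (eval q x))
eval-* (c ∷ p) q x = begin
  eval (c ·ₚ q +ₚ (0ℤ ∷ p *ₚ q)) x
    ≡⟨ eval-+ (c ·ₚ q) _ x ⟩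
  eval (c ·ₚ q) x ℤ.+ (0ℤ ℤ.+ x ℤ.* eval (p *ₚ q) x)
    ≡⟨ cong₂ (λ y z → y ℤ.+ (0ℤ ℤ.+ x ℤ.* z)) (eval-· c q x) (eval-* p q x) ⟩
  c ℤ.* eval q x ℤ.+ (0ℤ ℤ.+ x ℤ.* (eval p x ℤ.* eval q x))
    ≡⟨ lemma c x (eval p x) (eval q x) ⟩
  (c ℤ.+ x ℤ.* eval p x) ℤ.* eval q x ∎
  where
  open ≡-Reasoning

  lemma : ∀ c x y z → c ℤ.* z ℤ.+ (0ℤ ℤ.+ x ℤ.* (y ℤ.* z)) ≡ (c ℤ.+ x ℤ.* y) ℤ.* z
  lemma = solve-∀

eval-falling-suc : ∀ j x → eval (falling (suc j)) x ≡ eval (falling j) x ℤ.* (x ℤ.- + j)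
eval-falling-suc j x =
  trans (eval-* (falling j) _ x) (cong (λ y → eval (falling j) x ℤ.* y) (lemma x (ℤ.- + j)))
  where
  lemma : ∀ x y → 0ℤ ℤ.+ y ℤ.+ x ℤ.* (1ℤ ℤ.+ x ℤ.* 0ℤ) ≡ x ℤ.+ y
  lemma = solve-∀

eval-falling-suc-0 : ∀ j → eval (falling (suc j)) 0ℤ ≡ 0ℤ
eval-falling-suc-0 zero    = refl
eval-falling-suc-0 (suc j) = trans (eval-falling-suc (suc j) 0ℤ)
  (cong (λ y → y ℤ.* (0ℤ ℤ.- + suc j)) (eval-falling-suc-0 j))

eval-fallingSum-suc : ∀ a N x → eval (fallingSum a (suc N)) x ≡
                      eval (fallingSum a N) x ℤ.+ + a (suc N) ℤ.* eval (falling (suc N)) x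
eval-fallingSum-suc a N x = trans (eval-+ (fallingSum a N) _ x)
  (cong (λ y → eval (fallingSum a N) x ℤ.+ y) (eval-· (+ a (suc N)) (falling (suc N)) x))

eval-fallingSum-0 : ∀ a N → eval (fallingSum a N) 0ℤ ≡ 0ℤ
eval-fallingSum-0 a zero    = refl
eval-fallingSum-0 a (suc N) = trans (eval-fallingSum-suc a N 0ℤ)
  (cong₂ ℤ._+_ (eval-fallingSum-0 a N)
    (trans (cong (λ y → + a (suc N) ℤ.* y) (eval-falling-suc-0 N)) (ℤ.*-zeroʳ (+ a (suc N)))))

-- The value at 0 is the constant term, so it vanishes and the tail of the coefficient list is the
-- quotient by x.
root-0⇒∈xℤ[x] : ∀ p → eval p 0ℤ ≡ 0ℤ → p ∈xℤ[x]
-- The product `𝕩 *ₚ []` computes to `0ℤ ∷ 0ℤ ∷ []`, hence the three cases.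
root-0⇒∈xℤ[x] []      _  = [] , λ { zero → refl ; (suc zero) → refl ; (suc (suc i)) → refl }
root-0⇒∈xℤ[x] (c ∷ p) eq = p , λ { zero → trans c≡0 (sym (constant p)) ; (suc i) → sym (shift p i) }
  where
  c≡0 : c ≡ 0ℤ
  c≡0 = trans (sym (ℤ.+-identityʳ c))
    (trans (cong (λ y → c ℤ.+ y) (sym (ℤ.*-zeroˡ (eval p 0ℤ)))) eq)

  constant : ∀ p → coeff (𝕩 *ₚ p) 0 ≡ 0ℤ
  constant []      = refl
  constant (c ∷ p) = trans (ℤ.+-identityʳ _) (ℤ.*-zeroˡ c)

  coeff-+ : ∀ p q i → coeff (p +ₚ q) i ≡ coeff p i ℤ.+ coeff q i
  coeff-+ []      q       i       = sym (ℤ.+-identityˡ _)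
  coeff-+ (c ∷ p) []      i       = sym (ℤ.+-identityʳ _)
  coeff-+ (c ∷ p) (d ∷ q) zero    = refl
  coeff-+ (c ∷ p) (d ∷ q) (suc i) = coeff-+ p q i

  coeff-· : ∀ c p i → coeff (c ·ₚ p) i ≡ c ℤ.* coeff p i
  coeff-· c []      i       = sym (ℤ.*-zeroʳ c)
  coeff-· c (d ∷ p) zero    = refl
  coeff-· c (d ∷ p) (suc i) = coeff-· c p i

  coeff-0 : ∀ i → coeff (0ℤ ∷ []) i ≡ 0ℤ
  coeff-0 zero    = refl
  coeff-0 (suc i) = refl

  shift : ∀ p i → coeff (𝕩 *ₚ p) (suc i) ≡ coeff p i
  shift p i = begin
    coeff (0ℤ ·ₚ p +ₚ (0ℤ ∷ (1ℤ ·ₚ p +ₚ (0ℤ ∷ [])))) (suc i)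
      ≡⟨ coeff-+ (0ℤ ·ₚ p) _ (suc i) ⟩
    coeff (0ℤ ·ₚ p) (suc i) ℤ.+ coeff (1ℤ ·ₚ p +ₚ (0ℤ ∷ [])) i
      ≡⟨ cong₂ ℤ._+_ (coeff-· 0ℤ p (suc i)) (coeff-+ (1ℤ ·ₚ p) _ i) ⟩
    0ℤ ℤ.* coeff p (suc i) ℤ.+ (coeff (1ℤ ·ₚ p) i ℤ.+ coeff (0ℤ ∷ []) i)
      ≡⟨ cong₂ (λ y z → 0ℤ ℤ.* coeff p (suc i) ℤ.+ (y ℤ.+ z)) (coeff-· 1ℤ p i) (coeff-0 i) ⟩
    0ℤ ℤ.* coeff p (suc i) ℤ.+ (1ℤ ℤ.* coeff p i ℤ.+ 0ℤ)
      ≡⟨ lemma (coeff p (suc i)) (coeff p i) ⟩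
    coeff p i ∎
    where
    open ≡-Reasoning

    lemma : ∀ y z → 0ℤ ℤ.* y ℤ.+ (1ℤ ℤ.* z ℤ.+ 0ℤ) ≡ z
    lemma = solve-∀

-- Numbers of arrangements as values of falling factorials

length-cartesianProductWith : ∀ {A B C : Set} (f : A → B → C) xs ys →
                              length (cartesianProductWith f xs ys) ≡ length xs ℕ.* length ys
length-cartesianProductWith f []       ys = refl
length-cartesianProductWith f (x ∷ xs) ys =
  trans (length-++ (List.map (f x) ys))
    (cong₂ ℕ._+_ (length-map (f x) ys) (length-cartesianProductWith f xs ys))

length-arrangements-suc : ∀ j k →
  + length (arrangements (suc j) (suc k)) ≡ + suc k ℤ.* + length (arrangements j k)
length-arrangements-suc j k = trans
  (cong +_ (trans (length-cartesianProductWith _∷_ (allFin (suc k)) (arrangements j k))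
                  (cong (ℕ._* length (arrangements j k)) (length-tabulate {n = suc k} id))))
  (ℤ.pos-* (suc k) _)

-- (x)_(j+1) = x (x-1)_j is the recursion of the arrangements, and
-- (x)_(j+1) = (x)_j (x-j) that of the polynomials.

length-arrangements-last : ∀ j k →
  + length (arrangements (suc j) k) ≡ + length (arrangements j k) ℤ.* (+ k ℤ.- + j)
length-arrangements-last zero    zero    = refl
length-arrangements-last zero    (suc k) = trans (length-arrangements-suc zero k) (lemma (+ suc k))
  where
  lemma : ∀ x → x ℤ.* 1ℤ ≡ 1ℤ ℤ.* (x ℤ.- 0ℤ)
  lemma = solve-∀
length-arrangements-last (suc j) zero    = refl
length-arrangements-last (suc j) (suc k) = begin
  + length (arrangements (suc (suc j)) (suc k))
    -- Splitting off the first color lowers both `j` and `k` by one, which leaves the last factor k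
    -- - j unchanged.
    ≡⟨ length-arrangements-suc (suc j) k ⟩
  + suc k ℤ.* + length (arrangements (suc j) k)
    ≡⟨ cong (λ y → + suc k ℤ.* y) (length-arrangements-last j k) ⟩
  + suc k ℤ.* (+ length (arrangements j k) ℤ.* (+ k ℤ.- + j))
    ≡⟨ lemma (+ k) (+ j) (+ length (arrangements j k)) ⟩
  + suc k ℤ.* + length (arrangements j k) ℤ.* (+ suc k ℤ.- + suc j)
    ≡⟨ cong (λ y → y ℤ.* (+ suc k ℤ.- + suc j)) (length-arrangements-suc j k) ⟨
  + length (arrangements (suc j) (suc k)) ℤ.* (+ suc k ℤ.- + suc j) ∎
  where
  open ≡-Reasoning

  lemma : ∀ x y z → (1ℤ ℤ.+ x) ℤ.* (z ℤ.* (x ℤ.- y)) ≡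
                    (1ℤ ℤ.+ x) ℤ.* z ℤ.* ((1ℤ ℤ.+ x) ℤ.- (1ℤ ℤ.+ y))
  lemma = solve-∀

length-arrangements : ∀ j k → + length (arrangements j k) ≡ eval (falling j) (+ k)
length-arrangements zero    k = sym (lemma (+ k))
  where
  lemma : ∀ x → 1ℤ ℤ.+ x ℤ.* 0ℤ ≡ 1ℤ
  lemma = solve-∀
length-arrangements (suc j) k = trans (length-arrangements-last j k)
  (trans (cong (λ y → y ℤ.* (+ k ℤ.- + j)) (length-arrangements j k)) (sym (eval-falling-suc j (+ k))))

-- Subsets and images

module _ {n : ℕ} {P : Fin n → Set} (P? : Decidable P) where

  ∈-decide⁺ : ∀ {e} → P e → e ∈ tabulate (does ∘ P?)
  ∈-decide⁺ {e} pe = lookup⇒[]= e _ (trans (lookup∘tabulate (does ∘ P?) e) (dec-true (P? e) pe))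

  ∈-decide⁻ : ∀ {e} → e ∈ tabulate (does ∘ P?) → P e
  ∈-decide⁻ {e} e∈ = invert (subst (Reflects (P e)) does≡true (proof (P? e)))
    where
    does≡true : does (P? e) ≡ true
    does≡true = trans (sym (lookup∘tabulate (does ∘ P?) e)) ([]=⇒lookup e∈)

module _ {n k : ℕ} (ε : Fin n → Fin k) where

  ∈-image⁺ : ∀ {X e} → e ∈ X → ε e ∈ image ε X
  ∈-image⁺ {X} {e} e∈X = ∈-decide⁺ (λ c → any? λ e → (e ∈? X) ×-dec (ε e Fin.≟ c)) (e , e∈X , refl)

  ∈-image⁻ : ∀ X {c} → c ∈ image ε X → ∃[ e ] e ∈ X × ε e ≡ c
  ∈-image⁻ X = ∈-decide⁻ (λ c → any? λ e → (e ∈? X) ×-dec (ε e Fin.≟ c))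

∣p∪q∣≤∣p∣+∣q∣ : ∀ {n} (p q : Subset n) → ∣ p ∪ q ∣ ≤ ∣ p ∣ ℕ.+ ∣ q ∣
∣p∪q∣≤∣p∣+∣q∣ []            []            = z≤n
∣p∪q∣≤∣p∣+∣q∣ (outside ∷ p) (outside ∷ q) = ∣p∪q∣≤∣p∣+∣q∣ p q
∣p∪q∣≤∣p∣+∣q∣ (outside ∷ p) (inside ∷ q)  =
  subst (suc ∣ p ∪ q ∣ ≤_) (sym (+-suc ∣ p ∣ ∣ q ∣)) (s≤s (∣p∪q∣≤∣p∣+∣q∣ p q))
∣p∪q∣≤∣p∣+∣q∣ (inside ∷ p)  (s ∷ q)       =
  s≤s (≤-trans (∣p∪q∣≤∣p∣+∣q∣ p q) (+-monoʳ-≤ ∣ p ∣ (∣p∣≤∣x∷p∣ s q)))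

∣image∣≤ : ∀ {n k} (ε : Fin n → Fin k) X → ∣ image ε X ∣ ≤ ∣ X ∣
∣image∣≤ {k = k} ε [] = ≤-trans (p⊆q⇒∣p∣≤∣q∣ empty) (≤-reflexive (∣⊥∣≡0 k))
  where
  empty : image ε [] ⊆ ⊥
  empty c∈ with () , _ ← ∈-image⁻ ε [] c∈
∣image∣≤ ε (outside ∷ X) = ≤-trans (p⊆q⇒∣p∣≤∣q∣ sub) (∣image∣≤ (ε ∘ suc) X)
  where
  sub : image ε (outside ∷ X) ⊆ image (ε ∘ suc) X
  sub c∈ with suc e , there e∈X , refl ← ∈-image⁻ ε (outside ∷ X) c∈ = ∈-image⁺ (ε ∘ suc) e∈X
∣image∣≤ ε (inside ∷ X) = begin
  ∣ image ε (inside ∷ X) ∣                   ≤⟨ p⊆q⇒∣p∣≤∣q∣ sub ⟩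
  ∣ ⁅ ε zero ⁆ ∪ image (ε ∘ suc) X ∣         ≤⟨ ∣p∪q∣≤∣p∣+∣q∣ ⁅ ε zero ⁆ _ ⟩
  ∣ ⁅ ε zero ⁆ ∣ ℕ.+ ∣ image (ε ∘ suc) X ∣     ≡⟨ cong (ℕ._+ ∣ image (ε ∘ suc) X ∣) (∣⁅x⁆∣≡1 (ε zero)) ⟩
  suc ∣ image (ε ∘ suc) X ∣                  ≤⟨ s≤s (∣image∣≤ (ε ∘ suc) X) ⟩
  suc ∣ X ∣                                  ∎
  where
  open ≤-Reasoning
  sub : image ε (inside ∷ X) ⊆ ⁅ ε zero ⁆ ∪ image (ε ∘ suc) X
  sub c∈ with ∈-image⁻ ε (inside ∷ X) c∈
  ... | zero  , _         , refl = x∈p∪q⁺ (inj₁ (x∈⁅x⁆ (ε zero)))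
  ... | suc e , there e∈X , refl = x∈p∪q⁺ (inj₂ (∈-image⁺ (ε ∘ suc) e∈X))

-- By injectivity the color of the first element does not recur, so the image of the rest still fits
-- after that color is removed.
∣image∣≥ : ∀ {n k} (ε : Fin n → Fin k) X → (∀ {e f} → e ∈ X → f ∈ X → ε e ≡ ε f → e ≡ f) →
           ∣ X ∣ ≤ ∣ image ε X ∣
∣image∣≥ ε []            inj = z≤n
∣image∣≥ ε (outside ∷ X) inj =
  ≤-trans (∣image∣≥ (ε ∘ suc) X (λ e∈ f∈ eq → suc-injective (inj (there e∈) (there f∈) eq)))
          (p⊆q⇒∣p∣≤∣q∣ sub)
  where
  sub : image (ε ∘ suc) X ⊆ image ε (outside ∷ X)
  sub c∈ with e , e∈X , refl ← ∈-image⁻ (ε ∘ suc) X c∈ = ∈-image⁺ ε {outside ∷ X} (there e∈X)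
∣image∣≥ ε (inside ∷ X)  inj =
  ≤-trans
    (s≤s (≤-trans (∣image∣≥ (ε ∘ suc) X (λ e∈ f∈ eq → suc-injective (inj (there e∈) (there f∈) eq)))
                  (p⊆q⇒∣p∣≤∣q∣ sub)))
    (x∈p⇒∣p-x∣<∣p∣ (∈-image⁺ ε {inside ∷ X} here))
  where
  sub : image (ε ∘ suc) X ⊆ image ε (inside ∷ X) - ε zero
  sub c∈ with e , e∈X , refl ← ∈-image⁻ (ε ∘ suc) X c∈ =
    x∈p∧x≢y⇒x∈p-y (∈-image⁺ ε (there e∈X)) λ eq → contradiction (inj (there e∈X) here eq) λ ()

Collision : ∀ {n k} → (Fin n → Fin k) → Subset n → Set
Collision ε X = ∃₂ λ e f → (e ∈ X × f ∈ X × e ≢ f) × ε e ≡ ε f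

module _ {n k : ℕ} (ε : Fin n → Fin k) (X : Subset n) where

  -- The element `e` is redundant: `f` supplies the same color, so `X - e` already has the full
  -- image.
  collision⇒< : Collision ε X → ∣ image ε X ∣ < ∣ X ∣
  collision⇒< (e , f , (e∈X , f∈X , e≢f) , εe≡εf) =
    ≤-<-trans (≤-trans (p⊆q⇒∣p∣≤∣q∣ sub) (∣image∣≤ ε (X - e))) (x∈p⇒∣p-x∣<∣p∣ e∈X)
    where
    sub : image ε X ⊆ image ε (X - e)
    sub c∈ with ∈-image⁻ ε X c∈
    ... | g , g∈X , refl with g Fin.≟ e
    ...   | no  g≢e  = ∈-image⁺ ε (x∈p∧x≢y⇒x∈p-y g∈X g≢e)
    ...   | yes refl = subst (_∈ image ε (X - e)) (sym εe≡εf) (∈-image⁺ ε (x∈p∧x≢y⇒x∈p-y f∈X (e≢f ∘ sym)))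

  -- Pigeonhole principle. Collisions can be searched for, and if there is none then `ε` is
  -- injective on `X` and loses no elements.
  <⇒collision : ∣ image ε X ∣ < ∣ X ∣ → Collision ε X
  <⇒collision lt
    with any? (λ e → any? λ f → ((e ∈? X) ×-dec (f ∈? X) ×-dec ¬? (e Fin.≟ f)) ×-dec (ε e Fin.≟ ε f))
  ... | yes (e , f , coll) = e , f , coll
  ... | no  ¬coll = contradiction lt (≤⇒≯ (∣image∣≥ ε X inj))
    where
    inj : ∀ {e f} → e ∈ X → f ∈ X → ε e ≡ ε f → e ≡ f
    inj {e} {f} e∈X f∈X eq with e Fin.≟ f
    ... | yes e≡f = e≡f
    ... | no  e≢f = contradiction (e , f , (e∈X , f∈X , e≢f) , eq) ¬coll

-- Two distinct elements of a set form a collision of the coloring with one color.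

monochrome : ∀ {n} → Fin n → Fin 1
monochrome _ = zero

2≤∣p∣⇒ : ∀ {n} (p : Subset n) → 2 ≤ ∣ p ∣ → ∃₂ λ e f → e ∈ p × f ∈ p × e ≢ f
2≤∣p∣⇒ p 2≤
  with e , f , distinct , _ ←
    -- There is only one color, so the image has at most one element.
    <⇒collision monochrome p (≤-trans (s≤s (∣p∣≤n (image monochrome p))) 2≤) =
  e , f , distinct

2≤∣p∣⇐ : ∀ {n} (p : Subset n) {e f} → e ∈ p → f ∈ p → e ≢ f → 2 ≤ ∣ p ∣
2≤∣p∣⇐ p e∈p f∈p e≢f = ≤-<-trans
  -- The image contains a color, so it has at least one element, and the collision makes `p`
  -- strictly larger.
  (≤-<-trans z≤n (x∈p⇒∣p-x∣<∣p∣ (∈-image⁺ monochrome e∈p)))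
  (collision⇒< monochrome p (_ , _ , (e∈p , f∈p , e≢f) , refl))

-- Partitions as kernels

SameBlock : ∀ {n k} → Partition n k → Rel (Fin n) 0ℓ
SameBlock P e f = ∃[ i ] e ∈ block P i × f ∈ block P i

blockOf : ∀ {n k} → Partition n k → Fin n → Fin k
blockOf P e = proj₁ (covering P e)

module _ {n k : ℕ} (P : Partition n k) where

  ∈-blockOf : ∀ e → e ∈ block P (blockOf P e)
  ∈-blockOf e = proj₂ (covering P e)

  blockOf-unique : ∀ {e i} → e ∈ block P i → blockOf P e ≡ i
  blockOf-unique {e} {i} e∈ with blockOf P e Fin.≟ i
  ... | yes eq = eq
  ... | no  ≢i = contradiction (e , x∈p∩q⁺ (∈-blockOf e , e∈)) (disjoint P ≢i)

  blockOf-surjective : ∀ i → ∃[ e ] blockOf P e ≡ i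
  blockOf-surjective i with e , e∈ ← nonempty P i = e , blockOf-unique e∈

  sameBlock⇒ : ∀ {e f} → SameBlock P e f → blockOf P e ≡ blockOf P f
  sameBlock⇒ (i , e∈ , f∈) = trans (blockOf-unique e∈) (sym (blockOf-unique f∈))

  sameBlock⇐ : ∀ {e f} → blockOf P e ≡ blockOf P f → SameBlock P e f
  sameBlock⇐ {e} {f} eq = blockOf P f , subst (λ i → e ∈ block P i) eq (∈-blockOf e) , ∈-blockOf f

-- The last two hypotheses match block `i` of `P` with block `π i` of `Q`; since `π` is onto, every
-- block of `Q` is met.
relabel-≈ : ∀ {n k} (P Q : Partition n k) (π : Fin k → Fin k) → (∀ i → ∃[ j ] π j ≡ i) →
            (∀ i {e} → blockOf P e ≡ i → blockOf Q e ≡ π i) →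
            (∀ i {e} → blockOf Q e ≡ π i → blockOf P e ≡ i) →
            Setoid._≈_ (partitionSetoid n k) Q P
relabel-≈ P Q π π-surj to from =
    (λ i → let j , πj≡i = π-surj i in j , trans (cong (block Q) (sym πj≡i)) (sym (eq j)))
  , (λ j → π j , eq j)
  where
  eq : ∀ j → block P j ≡ block Q (π j)
  eq j = ⊆-antisym
    (λ {e} e∈ → subst (λ i → e ∈ block Q i) (to j (blockOf-unique P e∈)) (∈-blockOf Q e))
    (λ {e} e∈ → subst (λ i → e ∈ block P i) (from j (blockOf-unique Q e∈)) (∈-blockOf P e))

-- Lying in a common block depends only on the set of blocks, so the kernel of `blockOf` is
-- independent of the indexing.
≈⇒≈ₖ : ∀ {n k} (P Q : Partition n k) → Setoid._≈_ (partitionSetoid n k) P Q → blockOf P ≈ₖ blockOf Q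
≈⇒≈ₖ P Q (P≼Q , Q≼P) e f = half P Q P≼Q , half Q P Q≼P
  where
  half : ∀ P Q → (∀ i → ∃[ j ] block P i ≡ block Q j) →
         blockOf P e ≡ blockOf P f → blockOf Q e ≡ blockOf Q f
  half P Q P≼Q eq with i , e∈ , f∈ ← sameBlock⇐ P eq with j , same ← P≼Q i =
    sameBlock⇒ Q (j , subst (e ∈_) same e∈ , subst (f ∈_) same f∈)

partition : ∀ {n j} → RGS n j → Partition n j
partition r = record
  { block    = λ i → tabulate (λ e → does (label r e Fin.≟ i))
  ; nonempty = λ i → let e , eq = label-surjective r i in e , ∈-decide⁺ (λ e → label r e Fin.≟ i) eq
  ; disjoint = λ { {i} {j} i≢j (e , e∈) → let ∈i , ∈j = x∈p∩q⁻ _ _ e∈ in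
      i≢j (trans (sym (∈-decide⁻ (λ e → label r e Fin.≟ i) ∈i))
                 (∈-decide⁻ (λ e → label r e Fin.≟ j) ∈j)) }
  -- With this choice `blockOf (partition r)` computes to `label r`, so facts about labels apply to
  -- it directly.
  ; covering = λ e → label r e , ∈-decide⁺ (λ f → label r f Fin.≟ label r e) refl
  }

partition-injective : ∀ {n j} {r s : RGS n j} →
                      Setoid._≈_ (partitionSetoid n j) (partition r) (partition s) → r ≡ s
partition-injective {r = r} {s} eq
  with refl ← label-canonical r s (≈⇒≈ₖ (partition r) (partition s) eq) = refl

-- Factorizing `blockOf P` gives a string with some number `l` of blocks and an injection `h` from
-- [l] to [j]. Blocks are nonempty, so `h` is also onto; hence `l` equals `j` and `h` merely renames
-- the blocks.
partition-surjective : ∀ {n j} (P : Partition n j) →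
                       ∃[ r ] Setoid._≈_ (partitionSetoid n j) P (partition r)
partition-surjective {n} {j} P with l , r , h , h-inj , eq ← factorize (blockOf P) =
  conclude r h h-inj h-surj eq (cantor-schröder-bernstein h-inj section-inj)
  where
  h-surj : ∀ i → ∃[ m ] h m ≡ i
  h-surj i with e , refl ← blockOf-surjective P i = label r e , eq e

  section-inj : Injective _≡_ _≡_ (proj₁ ∘ h-surj)
  section-inj {i} {m} eq = trans (sym (proj₂ (h-surj i))) (trans (cong h eq) (proj₂ (h-surj m)))

  -- The number `l` is general here, so that the equation with `j` can be matched against `refl`.
  conclude : ∀ {l} (r : RGS n l) (h : Fin l → Fin j) → Injective _≡_ _≡_ h →
             (∀ i → ∃[ m ] h m ≡ i) → h ∘ label r ≗ blockOf P → l ≡ j →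
             ∃[ r ] Setoid._≈_ (partitionSetoid n j) P (partition r)
  conclude r h h-inj h-surj eq refl = r
    , relabel-≈ (partition r) P h h-surj
        (λ i {e} label≡ → trans (sym (eq e)) (cong h label≡))
        (λ i {e} block≡ → h-inj (trans (eq e) block≡))

-- Colorings and partitions defined by their kernels

Factored : ℕ → ℕ → Set
Factored n k = Σ ℕ λ j → RGS n j × Arrangement j k

decode : ∀ {n k} → Factored n k → Fin n → Fin k
decode (j , r , f) = apply f ∘ label r

decode-≈ₖ : ∀ {n k} ((j , r , f) : Factored n k) → decode (j , r , f) ≈ₖ label r
decode-≈ₖ (j , r , f) d e = apply-injective f , cong (apply f)

-- An injection does not change kernels, so equal colorings have strings with equal kernels, and
-- these strings coincide. As every label is attained, the two arrangements then agree everywhere.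
decode-injective : ∀ {n k} {x y : Factored n k} → decode x ≗ decode y → x ≡ y
decode-injective {x = j , r , f} {l , s , g} eq with label-canonical r s sameKernel
  where
  sameKernel : label r ≈ₖ label s
  sameKernel d e =
      (λ same → apply-injective g (trans (sym (eq d)) (trans (cong (apply f) same) (eq e))))
    , (λ same → apply-injective f (trans (eq d) (trans (cong (apply g) same) (sym (eq e)))))
... | refl with refl ← apply-cancel f g (λ i → let e , eqᵢ = label-surjective r i in
                  trans (cong (apply f) (sym eqᵢ)) (trans (eq e) (cong (apply g) eqᵢ))) = refl

decode-surjective : ∀ {n k} (ε : Fin n → Fin k) → ∃[ x ] decode {n} {k} x ≗ ε
decode-surjective ε with j , r , h , h-inj , eq ← factorize ε with f , f≗h ← arrange h h-inj =
  (j , r , f) , λ e → trans (f≗h (label r e)) (eq e)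

Ker : ∀ {n k} → (Fin n → Fin k) → Rel (Fin n) 0ℓ
Ker ε e f = ε e ≡ ε f

-- `G` is the condition imposed on the kernel. One kernel appears in several equivalent forms, as
-- `Ker ε`, `Ker (label r)` or `SameBlock P`; `mono` carries `G` from one form to another, and `G?`
-- lets the good strings be filtered out.
module KernelInvariant {n : ℕ} (G : Rel (Fin n) 0ℓ → Set) (mono : ∀ {R S} → R ⇒ S → G R → G S)
                       (G? : ∀ {R} → Binary.Decidable R → Dec (G R)) where

  good? : ∀ {j} → Decidable (λ (r : RGS n j) → G (Ker (label r)))
  good? r = G? (λ e f → label r e Fin.≟ label r f)

  good : ∀ j → List (RGS n j)
  good j = filter good? (rgs n j)

  ∈-good⁺ : ∀ {j} {r : RGS n j} → G (Ker (label r)) → r ∈ₗ good j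
  ∈-good⁺ {r = r} = ∈-filter⁺ good? (∈-rgs r)

  ∈-good⁻ : ∀ {j} {r : RGS n j} → r ∈ₗ good j → G (Ker (label r))
  ∈-good⁻ {j} r∈ = proj₂ (∈-filter⁻ good? {xs = rgs n j} r∈)

  good-unique : ∀ j → Unique (good j)
  good-unique j = Unique.filter⁺ good? (rgs-unique n j)

  #good : ℕ → ℕ
  #good j = length (good j)

  #good-vanishes : ∀ j → n < j → #good j ≡ 0
  #good-vanishes j n<j with good j
  ... | []    = refl
  ... | r ∷ _ = contradiction n<j (≤⇒≯ (RGS⇒≤ r))

  module _ (k : ℕ) where

    goodWith : ℕ → List (Factored n k)
    goodWith j = cartesianProductWith (λ r f → j , r , f) (good j) (arrangements j k)

    -- The block numbers run from 1 to `N`, in step with `fallingSum`.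
    factored : ℕ → List (Factored n k)
    factored zero    = []
    factored (suc N) = factored N ++ goodWith (suc N)

    ∈-goodWith⁻ : ∀ {j x} → x ∈ₗ goodWith j → proj₁ x ≡ j × G (Ker (label (proj₁ (proj₂ x))))
    ∈-goodWith⁻ {j} x∈
      with _ , _ , r∈ , _ , refl ← ∈-cartesianProductWith⁻ _ (good j) (arrangements j k) x∈ =
      refl , ∈-good⁻ r∈

    ∈-factored⁺ : ∀ {N x} → 1 ≤ proj₁ x → proj₁ x ≤ N → G (Ker (label (proj₁ (proj₂ x)))) →
                  x ∈ₗ factored N
    ∈-factored⁺ {zero}  {suc j , _}  _   ()  _
    ∈-factored⁺ {suc N} {j , r , f} 1≤j j≤N g with m≤n⇒m<n∨m≡n j≤N
    ... | inj₁ j<N  = ∈-++⁺ˡ (∈-factored⁺ 1≤j (≤-pred j<N) g)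
    ... | inj₂ refl = ∈-++⁺ʳ (factored N)
      (∈-cartesianProductWith⁺ _ (∈-good⁺ g) (∈-arrangements f))

    ∈-factored⁻ : ∀ {N x} → x ∈ₗ factored N → proj₁ x ≤ N × G (Ker (label (proj₁ (proj₂ x))))
    ∈-factored⁻ {suc N} x∈ with ∈-++⁻ (factored N) x∈
    ... | inj₁ x∈₁ = let j≤N , g = ∈-factored⁻ x∈₁ in m≤n⇒m≤1+n j≤N , g
    ... | inj₂ x∈₂ = let j≡ , g = ∈-goodWith⁻ x∈₂ in ≤-reflexive j≡ , g

    factored-unique : ∀ N → Unique (factored N)
    factored-unique zero    = []
    factored-unique (suc N) = Unique.++⁺ (factored-unique N)
      (Unique.cartesianProductWith⁺ _ (λ { refl → refl , refl })
        (good-unique (suc N)) (arrangements-unique (suc N) k))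
      (λ (x∈₁ , x∈₂) → ≤⇒≯ (proj₁ (∈-factored⁻ x∈₁)) (≤-reflexive (sym (proj₁ (∈-goodWith⁻ x∈₂)))))

    -- Good strings and arrangements are chosen independently, so `j` blocks contribute `#good j`
    -- times the value of (x)_j at `k`.
    length-factored : ∀ N → + length (factored N) ≡ eval (fallingSum #good N) (+ k)
    length-factored zero    = refl
    length-factored (suc N) = begin
      + length (factored N ++ goodWith (suc N))
        ≡⟨ cong +_ (length-++ (factored N)) ⟩
      + length (factored N) ℤ.+ + length (goodWith (suc N))
        ≡⟨ cong₂ (λ x y → x ℤ.+ + y) (length-factored N)
             (length-cartesianProductWith _ (good (suc N)) (arrangements (suc N) k)) ⟩
      eval (fallingSum #good N) (+ k) ℤ.+ + (#good (suc N) ℕ.* length (arrangements (suc N) k))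
        ≡⟨ cong (λ y → eval (fallingSum #good N) (+ k) ℤ.+ y)
             (trans (ℤ.pos-* (#good (suc N)) _)
                    (cong (λ y → + #good (suc N) ℤ.* y) (length-arrangements (suc N) k))) ⟩
      eval (fallingSum #good N) (+ k) ℤ.+ + #good (suc N) ℤ.* eval (falling (suc N)) (+ k)
        ≡⟨ eval-fallingSum-suc #good N (+ k) ⟨
      eval (fallingSum #good (suc N)) (+ k) ∎
      where open ≡-Reasoning

  module _ {k : ℕ} {IsColoring : (Fin n → Fin k) → Set}
           (to : ∀ ε → IsColoring ε → G (Ker ε)) (from : ∀ ε → G (Ker ε) → IsColoring ε) where

    -- A string on n elements has at most n blocks, so `factored k n` reaches far enough.
    -- Nonemptiness ensures at least one block: the coloring of an empty ground set would factor
    -- through zero blocks, a term outside the sum.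
    coloring-card : .{{_ : NonZero n}} →
                    HasCard (On.setoid (Fin n →-setoid Fin k) (proj₁ {B = IsColoring}))
                            (length (factored k n))
    coloring-card = subst (HasCard _) (length-map decode (factored k n))
      (hasCard-length (Fin n →-setoid Fin k) (List.map decode (factored k n))
        (SetoidUniqueₚ.map⁺ (setoid _) (Fin n →-setoid Fin k) decode-injective (factored-unique k n))
        (All.map⁺ (All.tabulate λ {x} x∈ →
          from (decode x)
            (mono (λ {e} {f} → proj₂ (decode-≈ₖ x e f)) (proj₂ (∈-factored⁻ k {n} x∈)))))
        complete)
      where
      complete : ∀ {ε} → IsColoring ε →
                 SetoidMembership._∈_ (Fin n →-setoid Fin k) ε (List.map decode (factored k n))
      complete {ε} ok with x@(j , r , f) , eq ← decode-surjective ε =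
        SetoidMembershipₚ.∈-resp-≈ (Fin n →-setoid Fin k) eq
          (SetoidMembershipₚ.∈-map⁺ (setoid _) (Fin n →-setoid Fin k) (λ { refl _ → refl })
            (∈-factored⁺ k {x = x} (positive r) (RGS⇒≤ r) (mono kernel (to ε ok))))
        where
        positive : ∀ {n} .{{_ : NonZero n}} {j} → RGS n j → 1 ≤ j
        positive {suc _} = RGS-nonempty

        kernel : Ker ε ⇒ Ker (label r)
        kernel {d} {e} same = proj₁ (decode-≈ₖ x d e) (trans (eq d) (trans same (sym (eq e))))

  module _ {j : ℕ} {IsPartition : Partition n j → Set}
           (to : ∀ P → IsPartition P → G (SameBlock P))
           (from : ∀ P → G (SameBlock P) → IsPartition P) where

    partition-card : HasCard (On.setoid (partitionSetoid n j) (proj₁ {B = IsPartition})) (#good j)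
    partition-card = subst (HasCard _) (length-map partition (good j))
      (hasCard-length (partitionSetoid n j) (List.map partition (good j))
        (SetoidUniqueₚ.map⁺ (setoid _) (partitionSetoid n j)
          (λ {r} {s} → partition-injective {r = r} {s}) (good-unique j))
        (All.map⁺ (All.tabulate λ {r} r∈ →
          -- `sameBlock⇐` applies to `Ker (label r)` because `blockOf (partition r)` reduces to
          -- `label r`.
          from (partition r) (mono (sameBlock⇐ (partition r)) (∈-good⁻ r∈))))
        complete)
      where
      complete : ∀ {P} → IsPartition P →
                 SetoidMembership._∈_ (partitionSetoid n j) P (List.map partition (good j))
      complete {P} ok with r , P≈ ← partition-surjective P =
        SetoidMembershipₚ.∈-resp-≈ (partitionSetoid n j)
          {List.map partition (good j)} {partition r} {P}
          (Setoid.sym (partitionSetoid n j) {P} {partition r} P≈)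
          (SetoidMembershipₚ.∈-map⁺ (setoid _) (partitionSetoid n j)
            (λ { {s} refl → Setoid.refl (partitionSetoid n j) {partition s} })
            (∈-good⁺ {r = r}
              (mono (λ {e} {f} same → proj₁ (≈⇒≈ₖ P (partition r) P≈ e f) (sameBlock⇒ P same)) (to P ok))))

  -- The numbers `#good j` play both parts: they count the partitions into `j` blocks and are the
  -- coefficients in the count of colorings.
  chromaticPolynomial : .{{_ : NonZero n}}
    (IsColoring : ∀ {k} → (Fin n → Fin k) → Set)
    (IsPartition : ∀ {j} → Partition n j → Set) →
    (∀ {k} (ε : Fin n → Fin k) → IsColoring ε → G (Ker ε)) →
    (∀ {k} (ε : Fin n → Fin k) → G (Ker ε) → IsColoring ε) →
    (∀ {j} (P : Partition n j) → IsPartition P → G (SameBlock P)) →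
    (∀ {j} (P : Partition n j) → G (SameBlock P) → IsPartition P) →
    ∃[ p ] p ∈xℤ[x]
      × (∀ k → k ≥ 1 →
          ∃[ c ] HasCard (On.setoid (Fin n →-setoid Fin k) (proj₁ {B = IsColoring})) c
               × + c ≡ eval p (+ k))
      × (∃[ a ] (∀ j → j ≥ 1 →
                  HasCard (On.setoid (partitionSetoid n j) (proj₁ {B = IsPartition})) (a j))
              × IsFallingSum a p)
  chromaticPolynomial _ _ c⇒ c⇐ p⇒ p⇐ =
      fallingSum #good n
    , root-0⇒∈xℤ[x] (fallingSum #good n) (eval-fallingSum-0 #good n)
    , (λ k _ → length (factored k n) , coloring-card c⇒ c⇐ , length-factored k n)
    -- The sum stops at `n`, since no partition of [n] has more than n blocks.
    , #good , (λ j _ → partition-card p⇒ p⇐) , n , #good-vanishes , λ _ → refl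

-- Gallai and transitive colorings

allSubsets? : ∀ {n} {P : Subset n → Set} → Decidable P → Dec (∀ X → P X)
allSubsets? P? = map′ (λ ∄ X → decidable-stable (P? X) λ ¬p → ∄ (X , ¬p)) (λ ∀P (X , ¬p) → ¬p (∀P X))
                      (¬? (anySubset? (¬? ∘ P?)))

allSigned? : ∀ {n} {P : SignedSubset n → Set} → Decidable P → Dec (∀ X → P X)
allSigned? {P = P} P? = map′ uncurried (λ ∀P p q d → ∀P (signed p q d))
                             (allSubsets? λ p → allSubsets? λ q → at p q)
  where
  uncurried : (∀ p q → .(d : Empty (p ∩ q)) → P (signed p q d)) → ∀ X → P X
  uncurried ∀P (signed p q d) = ∀P p q d

  at : ∀ p q → Dec (.(d : Empty (p ∩ q)) → P (signed p q d))
  -- If the two parts meet, the irrelevant disjointness proof still yields a contradiction. If they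
  -- do not, irrelevance makes the proof found here as good as any other.
  at p q with nonempty? (p ∩ q)
  ... | yes ne = yes λ d → ⊥-elim-irr (d ne)
  ... | no  d  = map′ (λ pf _ → pf) (λ f → f d) (P? (signed p q d))

module _ {n : ℕ} (M : Matroid n) where
  open Matroid M using (Circuit; Circuit?)

  -- For `Ker ε` this unfolds to a `Collision` in every circuit. The relation occurs only in the
  -- last, positive component, which makes the condition monotone.
  GallaiKernel : Rel (Fin n) 0ℓ → Set
  GallaiKernel R = ∀ X → Circuit X → ∃₂ λ e f → (e ∈ X × f ∈ X × e ≢ f) × R e f

  gallaiKernel? : ∀ {R} → Binary.Decidable R → Dec (GallaiKernel R)
  gallaiKernel? R? = allSubsets? λ X → Circuit? X →-dec
    any? λ e → any? λ f → ((e ∈? X) ×-dec (f ∈? X) ×-dec ¬? (e Fin.≟ f)) ×-dec R? e f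

  gallaiPartition⇒ : ∀ {j} (P : Partition n j) → IsGallaiPartition M P → GallaiKernel (SameBlock P)
  gallaiPartition⇒ P ok X c with i , 2≤ ← ok X c
                            with e , f , e∈ , f∈ , e≢f ← 2≤∣p∣⇒ (X ∩ block P i) 2≤ =
    let e∈X , e∈i = x∈p∩q⁻ X _ e∈
        f∈X , f∈i = x∈p∩q⁻ X _ f∈
    in e , f , (e∈X , f∈X , e≢f) , i , e∈i , f∈i

  gallaiPartition⇐ : ∀ {j} (P : Partition n j) → GallaiKernel (SameBlock P) → IsGallaiPartition M P
  gallaiPartition⇐ P g X c with e , f , (e∈X , f∈X , e≢f) , i , e∈i , f∈i ← g X c =
    i , 2≤∣p∣⇐ (X ∩ block P i) (x∈p∩q⁺ (e∈X , e∈i)) (x∈p∩q⁺ (f∈X , f∈i)) e≢f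

module _ {n : ℕ} (M : OrientedMatroid n) where
  open OrientedMatroid M using (Circuit; Circuit?)

  TransitiveKernel : Rel (Fin n) 0ℓ → Set
  TransitiveKernel R = ∀ X → Circuit X → ∃₂ λ e f → (e ∈ X ⁺ × f ∈ X ⁻) × R e f

  transitiveKernel? : ∀ {R} → Binary.Decidable R → Dec (TransitiveKernel R)
  transitiveKernel? R? = allSigned? λ X → Circuit? X →-dec
    any? λ e → any? λ f → ((e ∈? X ⁺) ×-dec (f ∈? X ⁻)) ×-dec R? e f

  transitiveColoring⇒ : ∀ {k} (ε : Fin n → Fin k) → IsTransitiveColoring M ε → TransitiveKernel (Ker ε)
  transitiveColoring⇒ ε ok X c with _ , ∈∩ ← ok X c
    with ∈⁺ , ∈⁻ ← x∈p∩q⁻ (image ε (X ⁺)) (image ε (X ⁻)) ∈∩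
    with e , e∈ , refl ← ∈-image⁻ ε (X ⁺) ∈⁺
    with f , f∈ , eq ← ∈-image⁻ ε (X ⁻) ∈⁻ = e , f , (e∈ , f∈) , sym eq

  transitiveColoring⇐ : ∀ {k} (ε : Fin n → Fin k) → TransitiveKernel (Ker ε) → IsTransitiveColoring M ε
  transitiveColoring⇐ ε g X c with e , f , (e∈ , f∈) , eq ← g X c =
    ε e , x∈p∩q⁺ (∈-image⁺ ε e∈ , subst (_∈ image ε (X ⁻)) (sym eq) (∈-image⁺ ε f∈))

  transitivePartition⇒ : ∀ {j} (P : Partition n j) →
                         IsTransitivePartition M P → TransitiveKernel (SameBlock P)
  transitivePartition⇒ P ok X c with i , (e , e∈) , (f , f∈) ← ok X c =
    let e∈⁺ , e∈i = x∈p∩q⁻ (X ⁺) _ e∈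
        f∈⁻ , f∈i = x∈p∩q⁻ (X ⁻) _ f∈
    in e , f , (e∈⁺ , f∈⁻) , i , e∈i , f∈i

  transitivePartition⇐ : ∀ {j} (P : Partition n j) →
                         TransitiveKernel (SameBlock P) → IsTransitivePartition M P
  transitivePartition⇐ P g X c with e , f , (e∈⁺ , f∈⁻) , i , e∈i , f∈i ← g X c =
    i , (e , x∈p∩q⁺ (e∈⁺ , e∈i)) , (f , x∈p∩q⁺ (f∈⁻ , f∈i))

proposition1p15 : (∀ (n : ℕ) .{{_ : NonZero n}} (M : Matroid n) → Loopless M →
    ∃[ p ] p ∈xℤ[x]
    × (∀ k → k ≥ 1 → ∃[ c ] HasCard (GallaiColorings M k) c × + c ≡ eval p (+ k))
    × (∃[ a ] (∀ j → j ≥ 1 → HasCard (GallaiPartitions M j) (a j)) × IsFallingSum a p))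
    ×
    (∀ (n : ℕ) .{{_ : NonZero n}} (M : OrientedMatroid n) → Acyclic M →
    ∃[ p ] p ∈xℤ[x]
    × (∀ k → k ≥ 1 → ∃[ c ] HasCard (TransitiveColorings M k) c × + c ≡ eval p (+ k))
    × (∃[ a ] (∀ j → j ≥ 1 → HasCard (TransitivePartitions M j) (a j)) × IsFallingSum a p))
proposition1p15 =
    (λ n M _ → KernelInvariant.chromaticPolynomial (GallaiKernel M)
      (λ R⇒S g X c → let e , f , ef , r = g X c in e , f , ef , R⇒S r) (gallaiKernel? M)
      (IsGallaiColoring M) (IsGallaiPartition M)
      (λ ε ok X c → <⇒collision ε X (ok X c)) (λ ε g X c → collision⇒< ε X (g X c))
      (gallaiPartition⇒ M) (gallaiPartition⇐ M))
  , (λ n M _ → KernelInvariant.chromaticPolynomial (TransitiveKernel M)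
      (λ R⇒S g X c → let e , f , ef , r = g X c in e , f , ef , R⇒S r) (transitiveKernel? M)
      (IsTransitiveColoring M) (IsTransitivePartition M)
      (transitiveColoring⇒ M) (transitiveColoring⇐ M)
      (transitivePartition⇒ M) (transitivePartition⇐ M))
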